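{- Let $w_1,w_2,w_3$ be any positive integers, let $n\ge 0$ be an integer and let $y\in\mathbb{Z}_p$. Then \begin{align*} &\sum_{k+l+m=n}\binom{n}{k,l,m}E_{k,q^{w_3}}(w_1y)E_{l,q^{w_1}}(w_2y)E_{m,q^{w_2}}(w_3y)\,w_3^{k}w_1^{l}w_2^{m}\\ =&\sum_{k+l+m=n}\binom{n}{k,l,m}E_{k,q^{w_2}}(w_1y)E_{l,q^{w_1}}(w_3y)E_{m,q^{w_3}}(w_2y)\,w_2^{k}w_1^{l}w_3^{m}. \end{align*}
   Context: Let $p$ be a fixed odd prime, $\mathbb{C}_p$ the completion of an algebraic closure of $\mathbb{Q}_p$ with absolute value normalized by $|p|_p=1/p$, and let $q\in\mathbb{C}_p$ be fixed with $|q-1|_p<p^{ -1/(p-1)}$. For $r\in\mathbb{C}_p$ with $|r-1|_p<p^{ -1/(p-1)}$ (in particular for $r=q^w$, $w$ a positive integer), the $r$-Euler polynomials $E_{n,r}(x)$ ($n\ge 0$) are the polynomials in $x$ defined by the generating function $$\frac{2}{re^{t}+1}e^{xt}=\sum_{n=0}^{\infty}E_{n,r}(x)\frac{t^n}{n!}.$$ Sums over $k+l+m=n$ run over all nonnegative integers $k,l,m$ with $k+l+m=n$, and $\binom{n}{k,l,m}=\frac{n!}{k!\,l!\,m!}$. -}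

module Defs where

open import Algebra.Apartness.Bundles using (HeytingCommutativeRing; HeytingField)
open import Algebra.Bundles using (CommutativeRing)
open import Algebra.Morphism.Structures using (module RingMorphisms)
import Algebra.Apartness.Properties.HeytingCommutativeRing
import Algebra.Definitions
import Algebra.Properties.Group
import Algebra.Properties.Ring
import Algebra.Properties.Semiring.Exp
import Algebra.Properties.Semiring.Sum
open import Data.Empty using (⊥)
open import Data.Fin.Base using (Fin; toℕ) renaming (zero to fzero; suc to fsuc)
open import Data.Integer.Base as ℤ using (+_)
import Data.Integer.Properties as ℤ
open import Data.Nat.Base as ℕ using (ℕ; zero; suc; _∸_; _!; NonZero; NonTrivial)
open import Data.Nat.Divisibility using (_∤_; divides)
open import Data.Nat.DivMod using (_%_; m≡m%n+[m/n]*n; m%n<n)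
open import Data.Nat.Primality using (Prime; prime⇒nonTrivial)
import Data.Nat.Properties as ℕ
open import Data.Product.Base using (∃-syntax; _×_; _,_; proj₁; proj₂)
open import Data.Rational.Base as ℚ using (ℚ; 0ℚ; 1ℚ; _/_; toℚᵘ)
import Data.Rational.Properties as ℚ
import Data.Rational.Unnormalised.Base as ℚᵘ
import Data.Rational.Unnormalised.Properties as ℚᵘ
open import Data.Sum.Base using (_⊎_; inj₁; inj₂)
open import Data.Vec.Base using (Vec; []; _∷_; head; lookup)
open import Data.Vec.Functional using (Vector)
open import Function.Bundles using (_⇔_; module Equivalence)
open import Level using (Level; _⊔_) renaming (suc to lsuc)
open import Relation.Binary.PropositionalEquality.Core as ≡ using (_≡_; _≢_)
open import Relation.Nullary.Construct.Add.Supremum using (_⁺; ⊤⁺; [_])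
open import Relation.Nullary.Negation using (¬_; contradiction)
open import Relation.Unary using (Pred; _∈_)
import Relation.Binary.Construct.Add.Supremum.NonStrict as NonStrict
import Relation.Binary.Construct.Add.Supremum.Strict as Strict
import Relation.Binary.Reasoning.Setoid

open NonStrict ℚ._≤_ public using (_≤⁺_; _≤⊤⁺) renaming ([_] to [_]≤)
open Strict ℚ._<_ public using (_<⁺_; [_]<⊤⁺) renaming ([_] to [_]<)

------------------------------------------------------------------------
-- ℚ ∪ {∞}, with ∞ written ⊤⁺

infixl 6 _+⁺_

_+⁺_ : ℚ ⁺ → ℚ ⁺ → ℚ ⁺
[ a ] +⁺ [ b ] = [ a ℚ.+ b ]
[ _ ] +⁺ ⊤⁺    = ⊤⁺
⊤⁺    +⁺ _     = ⊤⁺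

------------------------------------------------------------------------
-- Fields containing ℚ with an absolute value normalised by |p| = 1/p.
--
-- The absolute value is recorded additively: |x| = p^(- v x), where
-- |x| = 0 corresponds to v x = ⊤⁺.  Thus |x| < p^(-a) reads
-- [ a ] <⁺ v x, and |x| ≤ p^(-a) reads [ a ] ≤⁺ v x.  No real numbers
-- are needed because the value group of ℂₚ is p^ℚ.

record ValuedField (p : ℕ) (c ℓ₁ ℓ₂ : Level) : Set (lsuc (c ⊔ ℓ₁ ⊔ ℓ₂)) where
  field
    heytingField : HeytingField c ℓ₁ ℓ₂

  open HeytingField heytingField public
  open HeytingCommutativeRing heytingCommutativeRing public
    using (commutativeRing)
  open CommutativeRing commutativeRing public using (rawRing; semiring; ring)
  open Algebra.Properties.Semiring.Exp semiring public using (_^_)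
  open Algebra.Properties.Semiring.Sum semiring public using (sum; sum-syntax)
  open Algebra.Definitions _≈_ public using (Invertible)

  field
    ι                    : ℚ → Carrier
    ι-isRingHomomorphism :
      RingMorphisms.IsRingHomomorphism ℚ.+-*-rawRing rawRing ι

  fromℕ : ℕ → Carrier
  fromℕ n = ι (+ n / 1)

  field
    v      : Carrier → ℚ ⁺
    v-cong : ∀ {x y} → x ≈ y → v x ≡ v y
    v-#0   : ∀ x → x # 0# ⇔ v x ≢ ⊤⁺
    v-*    : ∀ x y → v (x * y) ≡ v x +⁺ v y
    -- |x + y| ≤ max (|x|, |y|)
    v-+    : ∀ x y → v x ≤⁺ v (x + y) ⊎ v y ≤⁺ v (x + y)
    v-p    : v (fromℕ p) ≡ [ 1ℚ ]

  Closure : ∀ {ℓ} → Pred Carrier ℓ → Pred Carrier (c ⊔ ℓ)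
  Closure S x = ∀ (a : ℚ) → ∃[ s ] s ∈ S × [ a ] ≤⁺ v (x - s)

  IsCauchy : (ℕ → Carrier) → Set
  IsCauchy s = ∀ (a : ℚ) → ∃[ N ] ∀ i j → N ℕ.≤ i → N ℕ.≤ j → [ a ] ≤⁺ v (s i - s j)

  _ConvergesTo_ : (ℕ → Carrier) → Carrier → Set
  s ConvergesTo x = ∀ (a : ℚ) → ∃[ N ] ∀ i → N ℕ.≤ i → [ a ] ≤⁺ v (s i - x)

  -- In a complete field, the closure of a subring is its completion, so
  -- ℤₚ and ℚₚ are found inside the field as the closures of ℤ and ℚ.
  ℤₚ : Pred Carrier (c ⊔ ℓ₁)
  ℤₚ = Closure λ x → ∃[ m ] x ≈ ι (m / 1)

  ℚₚ : Pred Carrier (c ⊔ ℓ₁)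
  ℚₚ = Closure λ x → ∃[ a ] x ≈ ι a

  -- The value at x of X^d + a_(d-1) X^(d-1) + ⋯ + a_0.
  evalMonic : ∀ {d} → Vector Carrier d → Carrier → Carrier
  evalMonic {d} a x = x ^ d + ∑[ i < d ] (a i * x ^ toℕ i)

  ℚ̄ₚ : Pred Carrier (c ⊔ ℓ₁)
  ℚ̄ₚ x = ∃[ d ] ∃[ a ] (∀ i → a i ∈ ℚₚ) × evalMonic {d} a x ≈ 0#

------------------------------------------------------------------------
-- ℂₚ, the completion of an algebraic closure of ℚₚ: a complete field in
-- which the elements algebraic over ℚₚ form an algebraically closed
-- field and are dense.  This determines ℂₚ up to isometric isomorphism.

record IsComplexPadic {p c ℓ₁ ℓ₂} (K : ValuedField p c ℓ₁ ℓ₂) : Set (c ⊔ ℓ₁ ⊔ ℓ₂) where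
  open ValuedField K
  field
    complete            : ∀ s → IsCauchy s → ∃[ x ] s ConvergesTo x
    algebraicallyClosed : ∀ d (a : Vector Carrier (suc d)) → (∀ i → a i ∈ ℚ̄ₚ) →
                          ∃[ x ] x ∈ ℚ̄ₚ × evalMonic a x ≈ 0#
    dense               : ∀ x → x ∈ Closure ℚ̄ₚ

record ℂₚ (p : ℕ) (c ℓ₁ ℓ₂ : Level) : Set (lsuc (c ⊔ ℓ₁ ⊔ ℓ₂)) where
  field
    valuedField    : ValuedField p c ℓ₁ ℓ₂
    isComplexPadic : IsComplexPadic valuedField

  open ValuedField valuedField public
  open IsComplexPadic isComplexPadic public

------------------------------------------------------------------------
-- Formal power series in t: f stands for ∑ₙ f(n) tⁿ

module PowerSeries {p c ℓ₁ ℓ₂} (C : ℂₚ p c ℓ₁ ℓ₂) where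
  open ℂₚ C

  Series : Set c
  Series = ℕ → Carrier

  infixl 6 _⊕_
  infixl 7 _⋆_ _·_

  const : Carrier → Series
  const a zero    = a
  const a (suc _) = 0#

  _⊕_ : Series → Series → Series
  (f ⊕ g) n = f n + g n

  _·_ : Carrier → Series → Series
  (a · f) n = a * f n

  _⋆_ : Series → Series → Series
  (f ⋆ g) n = ∑[ i < suc n ] (f (toℕ i) * g (n ∸ toℕ i))

  1/_! : ℕ → ℚ
  1/ n ! = (+ 1 / n !) {{n ℕ.!≢0}}

  -- e^(xt)
  exp : Carrier → Series
  exp x n = ι (1/ n !) * x ^ n

  -- The coefficients gₙ , … , g₀ of the inverse g of f, determined by
  -- f₀ g₀ = 1 and f₀ gₙ₊₁ = - ∑ᵢ fᵢ₊₁ gₙ₋ᵢ.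
  recipCoeffs : (f : Series) → Invertible 1# _*_ (f 0) → ∀ n → Vec Carrier (suc n)
  recipCoeffs f (u , _)      zero    = u ∷ []
  recipCoeffs f f₀⁻¹@(u , _) (suc n) =
    (- (u * ∑[ i < suc n ] (f (suc (toℕ i)) * lookup gs i))) ∷ gs
    where gs = recipCoeffs f f₀⁻¹ n

  recip : (f : Series) → Invertible 1# _*_ (f 0) → Series
  recip f f₀⁻¹ n = head (recipCoeffs f f₀⁻¹ n)

  private
    lookup-recipCoeffs : ∀ f f₀⁻¹ n (i : Fin (suc n)) →
                         lookup (recipCoeffs f f₀⁻¹ n) i ≡ recip f f₀⁻¹ (n ∸ toℕ i)
    lookup-recipCoeffs f f₀⁻¹ zero    fzero    = ≡.refl
    lookup-recipCoeffs f f₀⁻¹ (suc n) fzero    = ≡.refl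
    lookup-recipCoeffs f f₀⁻¹ (suc n) (fsuc i) = lookup-recipCoeffs f f₀⁻¹ n i

  recip-inverse : ∀ f f₀⁻¹ n → (f ⋆ recip f f₀⁻¹) n ≈ const 1# n
  recip-inverse f (u , _ , fu≈1) zero    = trans (+-identityʳ _) fu≈1
  recip-inverse f f₀⁻¹@(u , _ , fu≈1) (suc n) = begin
    f 0 * (- (u * S)) + S′  ≈⟨ +-congˡ (reflexive (sum-cong-≗ λ i →
                                 ≡.cong (f (suc (toℕ i)) *_)
                                   (≡.sym (lookup-recipCoeffs f f₀⁻¹ n i)))) ⟩
    f 0 * (- (u * S)) + S   ≈⟨ +-congʳ (sym (-‿distribʳ-* _ _)) ⟩
    - (f 0 * (u * S)) + S   ≈⟨ +-congʳ (-‿cong (sym (*-assoc _ _ _))) ⟩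
    - ((f 0 * u) * S) + S   ≈⟨ +-congʳ (-‿cong (*-congʳ fu≈1)) ⟩
    - (1# * S) + S          ≈⟨ +-congʳ (-‿cong (*-identityˡ S)) ⟩
    - S + S                 ≈⟨ -‿inverseˡ S ⟩
    0#                      ∎
    where
    open Relation.Binary.Reasoning.Setoid setoid
    open Algebra.Properties.Ring ring using (-‿distribʳ-*)
    open Algebra.Properties.Semiring.Sum semiring using (sum-cong-≗)
    S  = ∑[ i < suc n ] (f (suc (toℕ i)) * lookup (recipCoeffs f f₀⁻¹ n) i)
    S′ = ∑[ i < suc n ] (f (suc (toℕ i)) * recip f f₀⁻¹ (n ∸ toℕ i))

------------------------------------------------------------------------

module Euler {p c ℓ₁ ℓ₂} (p-prime : Prime p) (p-odd : 2 ∤ p) (C : ℂₚ p c ℓ₁ ℓ₂) where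
  open ℂₚ C public
  open PowerSeries C public

  private
    pred-nonZero : ∀ {m} → .{{NonTrivial m}} → NonZero (m ∸ 1)
    pred-nonZero {suc (suc _)} = _

  1/[p-1] : ℚ
  1/[p-1] = (+ 1 / (p ∸ 1)) {{pred-nonZero {{prime⇒nonTrivial p-prime}}}}

  -- |r - 1| < p^(-1/(p-1))
  InDisk : Pred Carrier _
  InDisk r = [ 1/[p-1] ] <⁺ v (r - 1#)

  Disk : Set c
  Disk = ∃[ r ] InDisk r

  private
    module ι = RingMorphisms.IsRingHomomorphism ι-isRingHomomorphism
    open Relation.Binary.Reasoning.Setoid setoid
    open Algebra.Apartness.Properties.HeytingCommutativeRing heytingCommutativeRing
      using (1#0; x-0≈x)

    0<1/[p-1] : 0ℚ ℚ.< 1/[p-1]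
    0<1/[p-1] = ℚ.positive⁻¹ 1/[p-1]
      {{ℚ.normalize-pos 1 (p ∸ 1) {{pred-nonZero {{prime⇒nonTrivial p-prime}}}}}}

    fromℕ-+ : ∀ m n → fromℕ (m ℕ.+ n) ≈ fromℕ m + fromℕ n
    fromℕ-+ m n = trans (reflexive (≡.cong ι (ℚ.toℚᵘ-injective eq))) (ι.+-homo _ _)
      where
      num : ℕ → ℚᵘ.ℚᵘ
      num k = ℚᵘ.mkℚᵘ (+ k) 0
      eq′ : num (m ℕ.+ n) ℚᵘ.≃ num m ℚᵘ.+ num n
      eq′ = ℚᵘ.*≡* (≡.cong (ℤ._* + 1)
              (≡.sym (≡.cong₂ ℤ._+_ (ℤ.*-identityʳ (+ m)) (ℤ.*-identityʳ (+ n)))))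
      eq : toℚᵘ (+ (m ℕ.+ n) / 1) ℚᵘ.≃ toℚᵘ (+ m / 1 ℚ.+ + n / 1)
      eq = ℚᵘ.≃-trans (ℚ.toℚᵘ-fromℚᵘ (num (m ℕ.+ n)))
          (ℚᵘ.≃-trans eq′
          (ℚᵘ.≃-trans (ℚᵘ.≃-sym (ℚᵘ.+-cong (ℚ.toℚᵘ-fromℚᵘ (num m)) (ℚ.toℚᵘ-fromℚᵘ (num n))))
            (ℚᵘ.≃-sym (ℚ.toℚᵘ-homo-+ (+ m / 1) (+ n / 1)))))

    fromℕ-1 : fromℕ 1 ≈ 1#
    fromℕ-1 = ι.1#-homo

    ⊤⇒≈0 : ∀ {x} → v x ≡ ⊤⁺ → x ≈ 0#
    ⊤⇒≈0 {x} vx≡⊤ = proj₁ (tight x 0#) λ x#0 → Equivalence.to (v-#0 x) x#0 vx≡⊤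

    v-0 : v 0# ≡ ⊤⁺
    v-0 with v 0# in eq
    ... | ⊤⁺    = ≡.refl
    ... | [ a ] = contradiction (Equivalence.from (v-#0 0#) λ v≡⊤ → case-⊥ (≡.trans (≡.sym eq) v≡⊤))
                                (#-irrefl refl)
      where
      case-⊥ : [ a ] ≡ ⊤⁺ → ⊥
      case-⊥ ()

    v-1 : v 1# ≡ [ 0ℚ ]
    v-1 with v 1# in eq
    ... | ⊤⁺    = contradiction eq (Equivalence.to (v-#0 1#) 1#0)
    ... | [ a ] = ≡.cong [_] (ℚ-idem a ([]-inj
                    (≡.trans (≡.sym eq) (≡.trans (v-cong (sym (*-identityˡ 1#)))
                      (≡.trans (v-* 1# 1#) (≡.cong₂ _+⁺_ eq eq))))))
      where
      []-inj : ∀ {a b : ℚ} → [ a ] ≡ [ b ] → a ≡ b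
      []-inj ≡.refl = ≡.refl
      ℚ-idem : ∀ a → a ≡ a ℚ.+ a → a ≡ 0ℚ
      ℚ-idem a eq = identityˡ-unique a a (≡.sym eq)
        where open Algebra.Properties.Group ℚ.+-0-group using (identityˡ-unique)

    v-+-< : ∀ {a x y} → a <⁺ v x → a <⁺ v y → a <⁺ v (x + y)
    v-+-< {x = x} {y} p q with v-+ x y
    ... | inj₁ le = Strict.<⁺-transˡ ℚ._<_ ℚ.<-≤-trans p le
    ... | inj₂ le = Strict.<⁺-transˡ ℚ._<_ ℚ.<-≤-trans q le

    v-+-≤ : ∀ {a x y} → a ≤⁺ v x → a ≤⁺ v y → a ≤⁺ v (x + y)
    v-+-≤ {x = x} {y} p q with v-+ x y
    ... | inj₁ le = NonStrict.≤⁺-trans ℚ._≤_ ℚ.≤-trans p le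
    ... | inj₂ le = NonStrict.≤⁺-trans ℚ._≤_ ℚ.≤-trans q le

    <⇒≤⁺ : ∀ {a b} → a <⁺ b → a ≤⁺ b
    <⇒≤⁺ [ p ]<     = [ ℚ.<⇒≤ p ]≤
    <⇒≤⁺ ([ k ]<⊤⁺) = [ k ] ≤⊤⁺

    +⁺-mono : ∀ {a x y} → [ 0ℚ ] ≤⁺ x → [ a ] <⁺ y → [ a ] <⁺ x +⁺ y
    +⁺-mono {a} [ p ]≤ [ q ]< =
      [ ≡.subst (ℚ._< _) (ℚ.+-identityˡ a) (ℚ.+-mono-≤-< p q) ]<
    +⁺-mono [ p ]≤      ([ k ]<⊤⁺) = [ k ]<⊤⁺
    +⁺-mono (_ ≤⊤⁺)     _          = [ _ ]<⊤⁺

    v-*-< : ∀ {a x y} → [ 0ℚ ] ≤⁺ v x → [ a ] <⁺ v y → [ a ] <⁺ v (x * y)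
    v-*-< {a} {x} {y} p q = ≡.subst ([ a ] <⁺_) (≡.sym (v-* x y)) (+⁺-mono p q)

    0≤v1 : [ 0ℚ ] ≤⁺ v 1#
    0≤v1 = ≡.subst ([ 0ℚ ] ≤⁺_) (≡.sym v-1) [ ℚ.≤-refl ]≤

    0≤v-fromℕ : ∀ n → [ 0ℚ ] ≤⁺ v (fromℕ n)
    0≤v-fromℕ zero    = ≡.subst ([ 0ℚ ] ≤⁺_) (≡.sym (≡.trans (v-cong ι.0#-homo) v-0)) ([ 0ℚ ] ≤⊤⁺)
    0≤v-fromℕ (suc n) = ≡.subst ([ 0ℚ ] ≤⁺_)
      (≡.sym (v-cong (trans (fromℕ-+ 1 n) (+-congʳ fromℕ-1))))
      (v-+-≤ 0≤v1 (0≤v-fromℕ n))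

    0<v[r-1] : ∀ {r} → InDisk r → [ 0ℚ ] <⁺ v (r - 1#)
    0<v[r-1] = Strict.<⁺-trans ℚ._<_ ℚ.<-trans [ 0<1/[p-1] ]<

    [x-y]+y≈x : ∀ x y → (x - y) + y ≈ x
    [x-y]+y≈x x y = trans (+-assoc x (- y) y) (trans (+-congˡ (-‿inverseˡ y)) (+-identityʳ x))

    odd-half : ∃[ k ] p ≡ 1 ℕ.+ (k ℕ.+ k)
    odd-half with p % 2 | m≡m%n+[m/n]*n p 2 | m%n<n p 2
    ... | 0 | p≡ | _ = contradiction (divides (p ℕ./ 2) p≡) p-odd
    ... | 1 | p≡ | _ = p ℕ./ 2 ,
          ≡.trans p≡ (≡.cong suc (≡.trans (ℕ.*-comm (p ℕ./ 2) 2)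
                                          (≡.cong (p ℕ./ 2 ℕ.+_) (ℕ.+-identityʳ _))))
    ... | suc (suc _) | _ | ℕ.s≤s (ℕ.s≤s ())

  -- If r + 1 were 0 and p = 2k + 1, then 1 = p + (r - 1) k would have
  -- absolute value less than 1.
  r+1#0 : ∀ {r} → InDisk r → r + 1# # 0#
  r+1#0 {r} r∈D = Equivalence.from (v-#0 (r + 1#)) λ v≡⊤ →
    0≮v1 (≡.subst ([ 0ℚ ] <⁺_) (v-cong (1≈ (⊤⇒≈0 v≡⊤))) (v-+-< 0<vp 0<v[r-1]k))
    where
    k = proj₁ odd-half
    K = fromℕ k

    0≮v1 : ¬ ([ 0ℚ ] <⁺ v 1#)
    0≮v1 lt with v 1# | v-1
    0≮v1 [ 0<0 ]< | _ | ≡.refl = ℚ.<-irrefl ≡.refl 0<0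

    0<vp : [ 0ℚ ] <⁺ v (fromℕ p)
    0<vp = ≡.subst ([ 0ℚ ] <⁺_) (≡.sym v-p) [ ℚ.positive⁻¹ 1ℚ ]<

    0<v[r-1]k : [ 0ℚ ] <⁺ v (K * (r - 1#))
    0<v[r-1]k = v-*-< (0≤v-fromℕ k) (0<v[r-1] r∈D)

    p≈ : fromℕ p ≈ 1# + (K + K)
    p≈ = begin
      fromℕ p                   ≈⟨ reflexive (≡.cong fromℕ (proj₂ odd-half)) ⟩
      fromℕ (1 ℕ.+ (k ℕ.+ k))   ≈⟨ fromℕ-+ 1 (k ℕ.+ k) ⟩
      fromℕ 1 + fromℕ (k ℕ.+ k) ≈⟨ +-cong fromℕ-1 (fromℕ-+ k k) ⟩
      1# + (K + K)              ∎

    1≈ : r + 1# ≈ 0# → fromℕ p + K * (r - 1#) ≈ 1#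
    1≈ r+1≈0 = begin
      fromℕ p + K * (r - 1#)                ≈⟨ +-congʳ p≈ ⟩
      1# + (K + K) + K * (r - 1#)           ≈⟨ +-assoc _ _ _ ⟩
      1# + (K + K + K * (r - 1#))           ≈⟨ +-congˡ (+-congʳ (+-cong K1 K1)) ⟩
      1# + (K * 1# + K * 1# + K * (r - 1#)) ≈⟨ +-congˡ (+-congʳ (distribˡ K 1# 1#)) ⟨
      1# + (K * (1# + 1#) + K * (r - 1#))   ≈⟨ +-congˡ (distribˡ K _ _) ⟨
      1# + K * (1# + 1# + (r - 1#))         ≈⟨ +-congˡ (*-congˡ (+-comm _ _)) ⟩
      1# + K * ((r - 1#) + (1# + 1#))       ≈⟨ +-congˡ (*-congˡ (+-assoc _ _ _)) ⟨
      1# + K * ((r - 1#) + 1# + 1#)         ≈⟨ +-congˡ (*-congˡ (+-congʳ ([x-y]+y≈x r 1#))) ⟩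
      1# + K * (r + 1#)                     ≈⟨ +-congˡ (*-congˡ r+1≈0) ⟩
      1# + K * 0#                           ≈⟨ +-congˡ (zeroʳ K) ⟩
      1# + 0#                               ≈⟨ +-identityʳ 1# ⟩
      1#                                    ∎
      where K1 = sym (*-identityʳ K)

  InDisk-^ : ∀ {q} → InDisk q → ∀ w → InDisk (q ^ w)
  InDisk-^ {q} q∈D zero = ≡.subst ([ 1/[p-1] ] <⁺_)
    (≡.sym (≡.trans (v-cong (-‿inverseʳ 1#)) v-0)) ([ 1/[p-1] ]<⊤⁺)
  InDisk-^ {q} q∈D (suc w) = ≡.subst ([ 1/[p-1] ] <⁺_) (v-cong eq)
    (v-+-< (v-*-< 0≤vq (InDisk-^ q∈D w)) q∈D)
    where
    0≤vq : [ 0ℚ ] ≤⁺ v q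
    0≤vq = ≡.subst ([ 0ℚ ] ≤⁺_) (v-cong ([x-y]+y≈x q 1#)) (v-+-≤ (<⇒≤⁺ (0<v[r-1] q∈D)) 0≤v1)

    eq : q * (q ^ w - 1#) + (q - 1#) ≈ q * q ^ w - 1#
    eq = begin
      q * (q ^ w - 1#) + (q - 1#)      ≈⟨ +-assoc _ _ _ ⟨
      q * (q ^ w - 1#) + q - 1#        ≈⟨ +-congʳ (+-congˡ (*-identityʳ q)) ⟨
      q * (q ^ w - 1#) + q * 1# - 1#   ≈⟨ +-congʳ (distribˡ q _ _) ⟨
      q * (q ^ w - 1# + 1#) - 1#       ≈⟨ +-congʳ (*-congˡ ([x-y]+y≈x (q ^ w) 1#)) ⟩
      q * q ^ w - 1#                   ∎

  infixr 8 _^ᴰ_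

  _^ᴰ_ : Disk → ℕ → Disk
  (q , q∈D) ^ᴰ w = q ^ w , InDisk-^ q∈D w

  -- r e^t + 1
  denominator : Carrier → Series
  denominator r = r · exp 1# ⊕ const 1#

  denominator₀-invertible : ∀ {r} → InDisk r → Invertible 1# _*_ (denominator r 0)
  denominator₀-invertible {r} r∈D = u , trans (*-congˡ eq) ul , trans (*-congʳ eq) ur
    where
    inverse = #⇒invertible (r+1#0 r∈D)
    u  = proj₁ inverse
    ul = proj₁ (proj₂ inverse)
    ur = proj₂ (proj₂ inverse)

    exp₀ : exp 1# 0 ≈ 1#
    exp₀ = trans (*-identityʳ (ι (1/ 0 !))) (trans (ι.⟦⟧-cong 1/0!≡1) ι.1#-homo)
      where
      1/0!≡1 : 1/ 0 ! ≡ 1ℚ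
      1/0!≡1 = ≡.refl

    eq : denominator r 0 ≈ (r + 1#) - 0#
    eq = trans (+-congʳ (trans (*-congˡ exp₀) (*-identityʳ r))) (sym (x-0≈x (r + 1#)))

  -- 2 / (r e^t + 1) · e^(xt)
  eulerSeries : Disk → Carrier → Series
  eulerSeries (r , r∈D) x =
    fromℕ 2 · recip (denominator r) (denominator₀-invertible r∈D) ⋆ exp x

  -- E n r x = E_{n,r}(x), that is, n! times the coefficient of tⁿ.
  E : ℕ → Disk → Carrier → Carrier
  E n r x = fromℕ (n !) * eulerSeries r x n

  multinomial : ℕ → ℕ → ℕ → ℕ → Carrier
  multinomial n k l m = ι ((+ (n !) / (k ! ℕ.* l ! ℕ.* m !)) {{k!l!m!≢0}})
    where k!l!m!≢0 = ℕ.m*n≢0 _ _ {{k ℕ.!* l !≢0}} {{m ℕ.!≢0}}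

  -- ∑ F k l m over all k , l , m with k + l + m = n
  ∑[k+l+m=_] : ℕ → (ℕ → ℕ → ℕ → Carrier) → Carrier
  ∑[k+l+m= n ] F =
    ∑[ k < suc n ] ∑[ l < suc (n ∸ toℕ k) ] F (toℕ k) (toℕ l) (n ∸ toℕ k ∸ toℕ l)

{-# OPTIONS --safe #-}

-- Both sides are n! times the tⁿ-coefficient of a product of three series.
-- Since wᵏ E_{k,r}(x) is the k-th exponential coefficient of
-- 2 / (r e^(wt) + 1) · e^(wxt), the factors multiply out to
--   ∏ᵢ 2 / (q^wᵢ e^(wᵢt) + 1) · e^(w₁w₂yt) e^(w₂w₃yt) e^(w₁w₃yt)
-- on either side; only the pairing of reciprocals with exponentials differs.
-- So commutativity and associativity of the Cauchy product suffice.
module Submission where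

open import Defs
open import Algebra.Bundles using (CommutativeRing; CommutativeSemiring; CommutativeSemigroup)
open import Algebra.Morphism.Structures using (module RingMorphisms)
import Algebra.Properties.CommutativeSemigroup as CommutativeSemigroupProperties
import Algebra.Properties.CommutativeSemiring.Exp
import Algebra.Properties.Semiring.Sum
open import Data.Fin.Base using (Fin; toℕ)
open import Data.Fin.Permutation using (reverse)
open import Data.Fin.Properties using (opposite-prop; toℕ≤pred[n])
open import Data.Integer.Base as ℤ using (+_)
import Data.Integer.Properties as ℤ
open import Data.Nat.Base as ℕ using (ℕ; NonZero; zero; suc; _∸_; _!)
open import Data.Nat.Divisibility using (_∤_)
open import Data.Nat.Primality using (Prime)
import Data.Nat.Properties as ℕ
open import Data.Product.Base using (_,_)
open import Data.Rational.Base as ℚ using (_/_; toℚᵘ)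
import Data.Rational.Properties as ℚ
import Data.Rational.Unnormalised.Base as ℚᵘ
import Data.Rational.Unnormalised.Properties as ℚᵘ
open import Data.Vec.Functional using (Vector)
open import Level using (Level)
open import Relation.Binary.PropositionalEquality.Core as ≡ using (_≡_)
import Relation.Binary.Reasoning.Setoid
open import Relation.Unary using (_∈_)

-- Products of fractions in ℚ.

m/d*d≡m : ∀ m d .{{_ : NonZero d}} → (+ m / d) ℚ.* (+ d / 1) ≡ + m / 1
-- `/` reduces to lowest terms, which is stuck on variables, so the product is compared in the
-- unnormalised rationals by cross-multiplication.
m/d*d≡m m d@(suc d-1) = ℚ.toℚᵘ-injective (begin
  toℚᵘ ((+ m / d) ℚ.* (+ d / 1))             ≈⟨ ℚ.toℚᵘ-homo-* (+ m / d) (+ d / 1) ⟩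
  toℚᵘ (+ m / d) ℚᵘ.* toℚᵘ (+ d / 1)         ≈⟨ ℚᵘ.*-cong (ℚ.toℚᵘ-fromℚᵘ (ℚᵘ.mkℚᵘ (+ m) d-1))
                                                          (ℚ.toℚᵘ-fromℚᵘ (ℚᵘ.mkℚᵘ (+ d) 0)) ⟩
  ℚᵘ.mkℚᵘ (+ m) d-1 ℚᵘ.* ℚᵘ.mkℚᵘ (+ d) 0     ≈⟨ ℚᵘ.*≡* cross ⟩
  ℚᵘ.mkℚᵘ (+ m) 0                            ≈⟨ ℚ.toℚᵘ-fromℚᵘ (ℚᵘ.mkℚᵘ (+ m) 0) ⟨
  toℚᵘ (+ m / 1)                             ∎)
  where
  open Relation.Binary.Reasoning.Setoid ℚᵘ.≃-setoid
  cross : (+ m ℤ.* + d) ℤ.* + 1 ≡ + m ℤ.* + (d ℕ.* 1)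
  cross = ≡.trans (ℤ.*-identityʳ _) (≡.cong (λ e → + m ℤ.* + e) (≡.sym (ℕ.*-identityʳ d)))

[m*n]/1≡m/1*n/1 : ∀ m n → + (m ℕ.* n) / 1 ≡ (+ m / 1) ℚ.* (+ n / 1)
[m*n]/1≡m/1*n/1 m n = ℚ.toℚᵘ-injective (begin
  toℚᵘ (+ (m ℕ.* n) / 1)                     ≈⟨ ℚ.toℚᵘ-fromℚᵘ (num (m ℕ.* n)) ⟩
  num (m ℕ.* n)                              ≈⟨ ℚᵘ.*≡* (≡.cong (ℤ._* + 1) (ℤ.pos-* m n)) ⟩
  num m ℚᵘ.* num n                           ≈⟨ ℚᵘ.*-cong (ℚ.toℚᵘ-fromℚᵘ (num m)) (ℚ.toℚᵘ-fromℚᵘ (num n)) ⟨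
  toℚᵘ (+ m / 1) ℚᵘ.* toℚᵘ (+ n / 1)         ≈⟨ ℚ.toℚᵘ-homo-* (+ m / 1) (+ n / 1) ⟨
  toℚᵘ ((+ m / 1) ℚ.* (+ n / 1))             ∎)
  where
  open Relation.Binary.Reasoning.Setoid ℚᵘ.≃-setoid
  num : ℕ → ℚᵘ.ℚᵘ
  num k = ℚᵘ.mkℚᵘ (+ k) 0

-- The Cauchy product over a commutative semiring.

module CauchyProduct {c ℓ} (R : CommutativeSemiring c ℓ) where
  open CommutativeSemiring R
  open Algebra.Properties.Semiring.Sum semiring
  open Algebra.Properties.CommutativeSemiring.Exp R using (_^_; ^-homo-*; ^-congʳ)
  open CommutativeSemigroupProperties *-commutativeSemigroup using (interchange)
  open Relation.Binary.Reasoning.Setoid setoid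

  infix  4 _≋_
  infixl 7 _⋆_

  _≋_ : (f g : ℕ → Carrier) → Set ℓ
  f ≋ g = ∀ n → f n ≈ g n

  _⋆_ : (f g : ℕ → Carrier) → ℕ → Carrier
  (f ⋆ g) n = ∑[ i < suc n ] (f (toℕ i) * g (n ∸ toℕ i))

  ⋆-cong : ∀ {f f′ g g′} → f ≋ f′ → g ≋ g′ → f ⋆ g ≋ f′ ⋆ g′
  ⋆-cong f≋f′ g≋g′ n = sum-cong-≋ {suc n} λ i → *-cong (f≋f′ (toℕ i)) (g≋g′ (n ∸ toℕ i))

  -- Reversing the index, `i` to `n ∸ i`, swaps the roles of the two factors.
  ⋆-comm : ∀ f g → f ⋆ g ≋ g ⋆ f
  ⋆-comm f g n = trans (sum-permute fg reverse) (sum-cong-≋ {suc n} λ i →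
    trans (*-comm _ _)
      (reflexive (≡.cong₂ (λ j k → g j * f k)
        -- Truncated subtraction gives `n ∸ (n ∸ i) = i` because `i ≤ n`.
        (≡.trans (≡.cong (n ∸_) (opposite-prop i)) (ℕ.m∸[m∸n]≡n (toℕ≤pred[n] i)))
        (opposite-prop i))))
    where
    fg : Vector Carrier (suc n)
    fg i = f (toℕ i) * g (n ∸ toℕ i)

  -- Both sides run over the triples of total `n`, grouped on the left by the sum of the first two
  -- entries and on the right by the first. Induction on `n` splits off the triples with first entry
  -- 0; `F` is arbitrary so that the hypothesis covers its shift.
  ∑-triangle : ∀ n (F : ℕ → ℕ → ℕ → Carrier) →
    ∑[ i < suc n ] ∑[ j < suc (toℕ i) ] F (toℕ j) (toℕ i ∸ toℕ j) (n ∸ toℕ i) ≈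
    ∑[ j < suc n ] ∑[ k < suc (n ∸ toℕ j) ] F (toℕ j) (toℕ k) (n ∸ toℕ j ∸ toℕ k)
  ∑-triangle zero    F = refl
  ∑-triangle (suc n) F = begin
    -- The row `i = 0` is a single term followed by an empty sum. In each later row `A` is the term
    -- `j = 0` and `B` the rest.
    (F 0 0 (suc n) + 0#) + ∑[ i < suc n ] (A i + B i)
      ≈⟨ +-cong (+-identityʳ _) (∑-distrib-+ A B) ⟩
    F 0 0 (suc n) + (∑[ i < suc n ] A i + ∑[ i < suc n ] B i)
      ≈⟨ +-assoc _ _ _ ⟨
    F 0 0 (suc n) + ∑[ i < suc n ] A i + ∑[ i < suc n ] B i
      ≈⟨ +-congˡ (∑-triangle n (λ j → F (suc j))) ⟩
    F 0 0 (suc n) + ∑[ i < suc n ] A i +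
      ∑[ j < suc n ] ∑[ k < suc (n ∸ toℕ j) ] F (suc (toℕ j)) (toℕ k) (n ∸ toℕ j ∸ toℕ k)
      ∎
    where
    A = λ i → F 0 (suc (toℕ i)) (n ∸ toℕ i)
    B = λ i → ∑[ j < suc (toℕ i) ] F (suc (toℕ j)) (toℕ i ∸ toℕ j) (n ∸ toℕ i)

  -- The right side has the index shape of `∑[k+l+m=_]`, so this serves the multinomial sum as well
  -- as associativity.
  ⋆-⋆-expand : ∀ f g h n → (f ⋆ (g ⋆ h)) n ≈
    ∑[ j < suc n ] ∑[ k < suc (n ∸ toℕ j) ] (f (toℕ j) * (g (toℕ k) * h (n ∸ toℕ j ∸ toℕ k)))
  ⋆-⋆-expand f g h n = sum-cong-≋ {suc n} λ j →
    *-distribˡ-sum {suc (n ∸ toℕ j)} (f (toℕ j)) λ k → g (toℕ k) * h (n ∸ toℕ j ∸ toℕ k)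

  -- By distributivity both bracketings become triple sums, which differ only in the order that
  -- `∑-triangle` exchanges.
  ⋆-assoc : ∀ f g h → (f ⋆ g) ⋆ h ≋ f ⋆ (g ⋆ h)
  ⋆-assoc f g h n = begin
    ((f ⋆ g) ⋆ h) n
      ≈⟨ sum-cong-≋ {suc n} (λ i → trans
           (*-distribʳ-sum {suc (toℕ i)} (h (n ∸ toℕ i)) λ j → f (toℕ j) * g (toℕ i ∸ toℕ j))
           (sum-cong-≋ {suc (toℕ i)} λ j →
             *-assoc (f (toℕ j)) (g (toℕ i ∸ toℕ j)) (h (n ∸ toℕ i)))) ⟩
    ∑[ i < suc n ] ∑[ j < suc (toℕ i) ] (f (toℕ j) * (g (toℕ i ∸ toℕ j) * h (n ∸ toℕ i)))
      ≈⟨ ∑-triangle n (λ j k m → f j * (g k * h m)) ⟩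
    ∑[ j < suc n ] ∑[ k < suc (n ∸ toℕ j) ] (f (toℕ j) * (g (toℕ k) * h (n ∸ toℕ j ∸ toℕ k)))
      ≈⟨ ⋆-⋆-expand f g h n ⟨
    (f ⋆ (g ⋆ h)) n
      ∎

  -- Bundled so that the generic rearrangement laws apply to products of series.
  ⋆-commutativeSemigroup : CommutativeSemigroup c ℓ
  ⋆-commutativeSemigroup = record
    { Carrier = ℕ → Carrier
    ; _≈_     = _≋_
    ; _∙_     = _⋆_
    ; isCommutativeSemigroup = record
      { isSemigroup = record
        { isMagma = record
          { isEquivalence = record
            { refl  = λ n → refl
            ; sym   = λ eq n → sym (eq n)
            ; trans = λ eq₁ eq₂ n → trans (eq₁ n) (eq₂ n)
            }
          ; ∙-cong = ⋆-cong
          }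
        ; assoc = ⋆-assoc
        }
      ; comm = ⋆-comm
      }
    }

  -- f(wt)
  scale : Carrier → (ℕ → Carrier) → ℕ → Carrier
  scale w f n = f n * w ^ n

  -- In degree `n` the power `w ^ n` splits as `w ^ i * w ^ (n ∸ i)`, one part for each factor.
  scale-⋆ : ∀ w f g → scale w (f ⋆ g) ≋ scale w f ⋆ scale w g
  scale-⋆ w f g n = trans (*-distribʳ-sum (w ^ n) fg) (sum-cong-≋ {suc n} λ i →
    trans (*-congˡ (trans (^-congʳ w (≡.sym (ℕ.m+[n∸m]≡n (toℕ≤pred[n] i))))
                          (^-homo-* w (toℕ i) (n ∸ toℕ i))))
          (interchange (f (toℕ i)) (g (n ∸ toℕ i)) _ _))
    where
    fg : Vector Carrier (suc n)
    fg i = f (toℕ i) * g (n ∸ toℕ i)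

-- Multinomial sums as coefficients of products of series.

module EulerIdentity {p c ℓ₁ ℓ₂} (p-prime : Prime p) (p-odd : 2 ∤ p) (C : ℂₚ p c ℓ₁ ℓ₂) where
  open Euler p-prime p-odd C hiding (_⋆_)
  open CommutativeRing commutativeRing using (commutativeSemiring)
  open CommutativeSemiring commutativeSemiring using (*-commutativeSemigroup)
  open CauchyProduct commutativeSemiring
  open Algebra.Properties.Semiring.Sum semiring using (sum-cong-≋; *-distribˡ-sum)
  open Algebra.Properties.CommutativeSemiring.Exp commutativeSemiring using (^-distrib-*; ^-congˡ)
  open CommutativeSemigroupProperties *-commutativeSemigroup using (interchange; x∙yz≈y∙xz)
  module ⋆ where
    open CommutativeSemigroup ⋆-commutativeSemigroup public
    open CommutativeSemigroupProperties ⋆-commutativeSemigroup public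
  module ι = RingMorphisms.IsRingHomomorphism ι-isRingHomomorphism

  fromℕ-* : ∀ m n → fromℕ (m ℕ.* n) ≈ fromℕ m * fromℕ n
  fromℕ-* m n = trans (ι.⟦⟧-cong ([m*n]/1≡m/1*n/1 m n)) (ι.*-homo _ _)

  -- Clears the denominator of the multinomial coefficient against the factorials that the three
  -- values of `E` carry; the cancellation happens in ℚ, under `ι`.
  multinomial-* : ∀ n k l m →
    multinomial n k l m * (fromℕ (k !) * fromℕ (l !) * fromℕ (m !)) ≈ fromℕ (n !)
  multinomial-* n k l m = begin
    multinomial n k l m * (fromℕ (k !) * fromℕ (l !) * fromℕ (m !))
      ≈⟨ *-congˡ (trans (fromℕ-* (k ! ℕ.* l !) (m !)) (*-congʳ (fromℕ-* (k !) (l !)))) ⟨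
    multinomial n k l m * fromℕ (k ! ℕ.* l ! ℕ.* m !)
      ≈⟨ ι.*-homo _ _ ⟨
    ι ((+ (n !) / (k ! ℕ.* l ! ℕ.* m !)) ℚ.* (+ (k ! ℕ.* l ! ℕ.* m !) / 1))
      ≈⟨ ι.⟦⟧-cong (m/d*d≡m (n !) (k ! ℕ.* l ! ℕ.* m !)) ⟩
    fromℕ (n !)
      ∎
    where
    open Relation.Binary.Reasoning.Setoid setoid
    instance
      k!l!m!≢0 : NonZero (k ! ℕ.* l ! ℕ.* m !)
      k!l!m!≢0 = ℕ.m*n≢0 _ _ {{k ℕ.!* l !≢0}} {{m ℕ.!≢0}}

  -- The multinomial convolution of exponential coefficients is the Cauchy product of ordinary ones;
  -- the powers of `a`, `b`, `c` are absorbed by rescaling `t`.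
  multinomial-sum : ∀ (f g h : Series) (a b c : Carrier) n →
    ∑[k+l+m= n ] (λ k l m → multinomial n k l m
      * (fromℕ (k !) * f k * (fromℕ (l !) * g l) * (fromℕ (m !) * h m))
      * (a ^ k * b ^ l * c ^ m))
    ≈ fromℕ (n !) * (scale a f ⋆ (scale b g ⋆ scale c h)) n
  multinomial-sum f g h a b c n = begin
    ∑[k+l+m= n ] (λ k l m → multinomial n k l m
      * (fromℕ (k !) * f k * (fromℕ (l !) * g l) * (fromℕ (m !) * h m))
      * (a ^ k * b ^ l * c ^ m))
      ≈⟨ sum-cong-≋ {suc n} (λ k → sum-cong-≋ {suc (n ∸ toℕ k)} λ l →
           term (toℕ k) (toℕ l) (n ∸ toℕ k ∸ toℕ l)) ⟩
    ∑[k+l+m= n ] (λ k l m → fromℕ (n !) * (scale a f k * (scale b g l * scale c h m)))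
      ≈⟨ trans (*-distribˡ-sum (fromℕ (n !)) (λ k → sum (summand k)))
                (sum-cong-≋ {suc n} λ k → *-distribˡ-sum (fromℕ (n !)) (summand k)) ⟨
    fromℕ (n !) * ∑[k+l+m= n ] (λ k l m → scale a f k * (scale b g l * scale c h m))
      ≈⟨ *-congˡ (⋆-⋆-expand (scale a f) (scale b g) (scale c h) n) ⟨
    fromℕ (n !) * (scale a f ⋆ (scale b g ⋆ scale c h)) n
      ∎
    where
    open Relation.Binary.Reasoning.Setoid setoid
    summand : (k : Fin (suc n)) → Vector Carrier (suc (n ∸ toℕ k))
    summand k l = scale a f (toℕ k) * (scale b g (toℕ l) * scale c h (n ∸ toℕ k ∸ toℕ l))

    interchange₃ : ∀ x x′ y y′ z z′ →
      x * x′ * (y * y′) * (z * z′) ≈ x * y * z * (x′ * y′ * z′)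
    interchange₃ x x′ y y′ z z′ =
      trans (*-congʳ (interchange x x′ y y′)) (interchange (x * y) (x′ * y′) z z′)

    term : ∀ k l m → multinomial n k l m
      * (fromℕ (k !) * f k * (fromℕ (l !) * g l) * (fromℕ (m !) * h m))
      * (a ^ k * b ^ l * c ^ m)
      ≈ fromℕ (n !) * (scale a f k * (scale b g l * scale c h m))
    term k l m = begin
      multinomial n k l m
        * (fromℕ (k !) * f k * (fromℕ (l !) * g l) * (fromℕ (m !) * h m))
        * (a ^ k * b ^ l * c ^ m)
        -- Collects the factorials, ready for `multinomial-*`.
        ≈⟨ *-congʳ (*-congˡ (interchange₃ _ _ _ _ _ _)) ⟩
      multinomial n k l m
        * (fromℕ (k !) * fromℕ (l !) * fromℕ (m !) * (f k * g l * h m))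
        * (a ^ k * b ^ l * c ^ m)
        ≈⟨ *-congʳ (trans (sym (*-assoc _ _ _)) (*-congʳ (multinomial-* n k l m))) ⟩
      fromℕ (n !) * (f k * g l * h m) * (a ^ k * b ^ l * c ^ m)
        ≈⟨ *-assoc _ _ _ ⟩
      fromℕ (n !) * (f k * g l * h m * (a ^ k * b ^ l * c ^ m))
        -- Used backwards, it hands each power to its own coefficient.
        ≈⟨ *-congˡ (interchange₃ _ _ _ _ _ _) ⟨
      fromℕ (n !) * (scale a f k * scale b g l * scale c h m)
        ≈⟨ *-congˡ (*-assoc _ _ _) ⟩
      fromℕ (n !) * (scale a f k * (scale b g l * scale c h m))
        ∎

  -- 2 / (r e^t + 1)
  eulerKernel : Disk → Series
  eulerKernel (r , r∈D) = fromℕ 2 · recip (denominator r) (denominator₀-invertible r∈D)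

  exp-cong : ∀ {x y} → x ≈ y → exp x ≋ exp y
  exp-cong x≈y n = *-congˡ (^-congˡ n x≈y)

  scale-exp : ∀ w x → scale w (exp x) ≋ exp (w * x)
  scale-exp w x n = trans (*-assoc _ _ _)
    (*-congˡ (trans (sym (^-distrib-* x w n)) (^-congˡ n (*-comm x w))))

  -- Rescaling `t` is multiplicative and takes `e^(xt)` to `e^(wxt)`. The product inside
  -- `eulerSeries` unfolds to the same sum as `_⋆_` here, so `scale-⋆` applies directly.
  scale-eulerSeries : ∀ w r x →
    scale w (eulerSeries r x) ≋ scale w (eulerKernel r) ⋆ exp (w * x)
  scale-eulerSeries w r x = ⋆.trans (scale-⋆ w (eulerKernel r) (exp x))
    (⋆.∙-congˡ {scale w (eulerKernel r)} (scale-exp w x))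

  -- The symmetry in three weights.

  module _ (q : Disk) (w₁ w₂ w₃ : ℕ) (y : Carrier) where
    private
      -- This is `2 / (q^w e^(wt) + 1)`. One `w` sets both base and scaling, since each Euler
      -- polynomial in the theorem is weighted by powers of the exponent of its base.
      D : ℕ → Series
      D w = scale (fromℕ w) (eulerKernel (q ^ᴰ w))

      X : ℕ → ℕ → Series
      X w w′ = exp (fromℕ w * (fromℕ w′ * y))

      -- The series is `e^(w w′ y t)`, so only the unordered pair of weights matters.
      X-comm : ∀ w w′ → X w w′ ≋ X w′ w
      X-comm w w′ = exp-cong (x∙yz≈y∙xz (fromℕ w) (fromℕ w′) y)

      T : ℕ → ℕ → Series
      T w w′ = eulerSeries (q ^ᴰ w) (fromℕ w′ * y)

      S : ℕ → ℕ → Series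
      S w w′ = scale (fromℕ w) (T w w′)

      -- Gathers reciprocals and exponentials into two groups that can then be permuted
      -- independently.
      separate : ∀ a a′ b b′ c c′ →
        S a a′ ⋆ (S b b′ ⋆ S c c′) ≋ (D a ⋆ (D b ⋆ D c)) ⋆ (X a a′ ⋆ (X b b′ ⋆ X c c′))
      separate a a′ b b′ c c′ = begin
        S a a′ ⋆ (S b b′ ⋆ S c c′)
          ≈⟨ ⋆.∙-cong (split a a′) (⋆.∙-cong (split b b′) (split c c′)) ⟩
        (D a ⋆ X a a′) ⋆ ((D b ⋆ X b b′) ⋆ (D c ⋆ X c c′))
          ≈⟨ ⋆.∙-congˡ {D a ⋆ X a a′} (⋆.interchange (D b) (X b b′) (D c) (X c c′)) ⟩
        (D a ⋆ X a a′) ⋆ ((D b ⋆ D c) ⋆ (X b b′ ⋆ X c c′))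
          ≈⟨ ⋆.interchange (D a) (X a a′) (D b ⋆ D c) (X b b′ ⋆ X c c′) ⟩
        (D a ⋆ (D b ⋆ D c)) ⋆ (X a a′ ⋆ (X b b′ ⋆ X c c′))
          ∎
        where
        open Relation.Binary.Reasoning.Setoid ⋆.setoid
        split : ∀ w w′ → S w w′ ≋ D w ⋆ X w w′
        split w w′ = scale-eulerSeries (fromℕ w) (q ^ᴰ w) (fromℕ w′ * y)

    -- The left side pairs weights along the cycle `w₃`, `w₁`, `w₂`, the right side along its
    -- reverse. Both cycles have the same vertices, giving the `D` factors, and the same undirected
    -- edges, giving the `X` factors.
    eulerSeries-symmetry : S w₃ w₁ ⋆ (S w₁ w₂ ⋆ S w₂ w₃) ≋ S w₂ w₁ ⋆ (S w₁ w₃ ⋆ S w₃ w₂)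
    eulerSeries-symmetry = begin
      S w₃ w₁ ⋆ (S w₁ w₂ ⋆ S w₂ w₃)
        ≈⟨ separate w₃ w₁ w₁ w₂ w₂ w₃ ⟩
      (D w₃ ⋆ (D w₁ ⋆ D w₂)) ⋆ (X w₃ w₁ ⋆ (X w₁ w₂ ⋆ X w₂ w₃))
        -- The `D` group exchanges its outer factors and the `X` group its first two; `X-comm` then
        -- reverses each edge.
        ≈⟨ ⋆.∙-cong (⋆.x∙yz≈z∙yx (D w₃) (D w₁) (D w₂))
                    (⋆.x∙yz≈y∙xz (X w₃ w₁) (X w₁ w₂) (X w₂ w₃)) ⟩
      (D w₂ ⋆ (D w₁ ⋆ D w₃)) ⋆ (X w₁ w₂ ⋆ (X w₃ w₁ ⋆ X w₂ w₃))
        ≈⟨ ⋆.∙-congˡ {D w₂ ⋆ (D w₁ ⋆ D w₃)}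
             (⋆.∙-cong (X-comm w₁ w₂) (⋆.∙-cong (X-comm w₃ w₁) (X-comm w₂ w₃))) ⟩
      (D w₂ ⋆ (D w₁ ⋆ D w₃)) ⋆ (X w₂ w₁ ⋆ (X w₁ w₃ ⋆ X w₃ w₂))
        ≈⟨ separate w₂ w₁ w₁ w₃ w₃ w₂ ⟨
      S w₂ w₁ ⋆ (S w₁ w₃ ⋆ S w₃ w₂)
        ∎
      where open Relation.Binary.Reasoning.Setoid ⋆.setoid

    multinomial-symmetry : ∀ n →
      ∑[k+l+m= n ] (λ k l m →
        multinomial n k l m
          * (E k (q ^ᴰ w₃) (fromℕ w₁ * y) * E l (q ^ᴰ w₁) (fromℕ w₂ * y) * E m (q ^ᴰ w₂) (fromℕ w₃ * y))
          * (fromℕ w₃ ^ k * fromℕ w₁ ^ l * fromℕ w₂ ^ m))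
      ≈
      ∑[k+l+m= n ] (λ k l m →
        multinomial n k l m
          * (E k (q ^ᴰ w₂) (fromℕ w₁ * y) * E l (q ^ᴰ w₁) (fromℕ w₃ * y) * E m (q ^ᴰ w₃) (fromℕ w₂ * y))
          * (fromℕ w₂ ^ k * fromℕ w₁ ^ l * fromℕ w₃ ^ m))
    multinomial-symmetry n =
      -- Each `E` unfolds to a factorial times a coefficient of some `T`, which is the form that
      -- `multinomial-sum` expects.
      trans (multinomial-sum (T w₃ w₁) (T w₁ w₂) (T w₂ w₃) (fromℕ w₃) (fromℕ w₁) (fromℕ w₂) n)
        (trans (*-congˡ (eulerSeries-symmetry n))
          (sym (multinomial-sum (T w₂ w₁) (T w₁ w₃) (T w₃ w₂) (fromℕ w₂) (fromℕ w₁) (fromℕ w₃) n)))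

theorem4p16 : ∀ {c ℓ₁ ℓ₂ : Level} {p : ℕ} (p-prime : Prime p) (p-odd : 2 ∤ p) (C : ℂₚ p c ℓ₁ ℓ₂) →
    let open Euler p-prime p-odd C in
    ∀ (q : Disk) (w₁ w₂ w₃ : ℕ) .{{_ : NonZero w₁}} .{{_ : NonZero w₂}} .{{_ : NonZero w₃}}
    (n : ℕ) (y : Carrier) → y ∈ ℤₚ →
    ∑[k+l+m= n ] (λ k l m →
    multinomial n k l m
    * (E k (q ^ᴰ w₃) (fromℕ w₁ * y) * E l (q ^ᴰ w₁) (fromℕ w₂ * y) * E m (q ^ᴰ w₂) (fromℕ w₃ * y))
    * (fromℕ w₃ ^ k * fromℕ w₁ ^ l * fromℕ w₂ ^ m))
    ≈
    ∑[k+l+m= n ] (λ k l m →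
    multinomial n k l m
    * (E k (q ^ᴰ w₂) (fromℕ w₁ * y) * E l (q ^ᴰ w₁) (fromℕ w₃ * y) * E m (q ^ᴰ w₃) (fromℕ w₂ * y))
    * (fromℕ w₂ ^ k * fromℕ w₁ ^ l * fromℕ w₃ ^ m))
theorem4p16 p-prime p-odd C q w₁ w₂ w₃ n y _ =
  EulerIdentity.multinomial-symmetry p-prime p-odd C q w₁ w₂ w₃ y n
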